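{- Let $G$ be a tree, let $p>1$ be an integer, and let $H$ be a finite collection of subgraphs of $G$, each consisting of at most $d$ connected components. If $H$ satisfies the $(p,p)$ property, then $\tau(H)< p^{\frac{1}{p-1}}d^{\frac{p}{p-1}} + d$.
   Context: $H$ satisfies the $(p,q)$ property if among any $p$ elements of $H$ there are some $q$ elements sharing a common vertex of $G$. $\tau(H)$ is the minimum size of a set of vertices of $G$ meeting (the vertex set of) every member of $H$.
   Formalization: The p elements in the (p,p) property may repeat, so if |H| < p all members must share a vertex (read vacuously, the claim fails: p=4, d=1, three disjoint vertices); d ≥ 1 is required (d=0 with H empty fails); the tree G is finite. -}

module Defs where

open import Data.Nat using (ℕ; zero; suc; _≤_)
open import Data.Fin using (Fin)
open import Data.List using (List; []; _∷_; length)
open import Data.List.Relation.Unary.Unique.Propositional using (Unique)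
open import Data.List.Membership.Propositional using (_∈_)
open import Data.Product using (Σ; ∃; _×_; _,_)
open import Relation.Binary.PropositionalEquality using (_≡_)
open import Relation.Nullary using (¬_)
open import Data.Empty using (⊥)

record Graph (n : ℕ) : Set₁ where
  field
    Adj   : Fin n → Fin n → Set
    sym   : ∀ {u v} → Adj u v → Adj v u
    irrefl : ∀ {u} → ¬ Adj u u
open Graph public

data Walk {n : ℕ} (G : Graph n) : Fin n → Fin n → Set where
  nil  : ∀ {u} → Walk G u u
  cons : ∀ {u w v} → Adj G u w → Walk G w v → Walk G u v

Connected : ∀ {n} → Graph n → Set
Connected G = ∀ u v → Walk G u v

data IsPath {n : ℕ} (G : Graph n) : List (Fin n) → Set where
  one  : ∀ {u} → IsPath G (u ∷ [])
  more : ∀ {u w vs} → Adj G u w → IsPath G (w ∷ vs) → IsPath G (u ∷ w ∷ vs)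

data LastAdj {n : ℕ} (G : Graph n) (u : Fin n) : List (Fin n) → Set where
  lastHere  : ∀ {v} → Adj G v u → LastAdj G u (v ∷ [])
  lastThere : ∀ {v w vs} → LastAdj G u (w ∷ vs) → LastAdj G u (v ∷ w ∷ vs)

Cycle : ∀ {n} → Graph n → List (Fin n) → Set
Cycle G [] = ⊥
Cycle G (u ∷ vs) =
  IsPath G (u ∷ vs) × Unique (u ∷ vs) × 3 ≤ length (u ∷ vs) × LastAdj G u vs

Acyclic : ∀ {n} → Graph n → Set
Acyclic G = ∀ cs → ¬ Cycle G cs

IsTree : ∀ {n} → Graph n → Set
IsTree G = Connected G × Acyclic G

record Subgraph {n : ℕ} (G : Graph n) : Set₁ where
  field
    V     : Fin n → Set
    E     : Fin n → Fin n → Set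
    E-sym : ∀ {u v} → E u v → E v u
    E-adj : ∀ {u v} → E u v → Adj G u v
    E-V   : ∀ {u v} → E u v → V u × V v
open Subgraph public

data Reach {n : ℕ} {G : Graph n} (S : Subgraph G) : Fin n → Fin n → Set where
  here : ∀ {u} → V S u → Reach S u u
  step : ∀ {u w v} → E S u w → Reach S w v → Reach S u v

AtMostComponents : ∀ {n} {G : Graph n} → ℕ → Subgraph G → Set
AtMostComponents {n} d S =
  Σ (Fin d → Fin n) λ r → ∀ v → V S v → Σ (Fin d) λ j → Reach S (r j) v

-- The (p,p) property for a finite collection H = (H 0, …, H (m-1)):
-- any p members of H (chosen from the collection, repetitions allowed)
-- share a common vertex of G.
PPProperty : ∀ {n} {G : Graph n} {m : ℕ} → ℕ → (Fin m → Subgraph G) → Set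
PPProperty {n} {m = m} p H =
  (f : Fin p → Fin m) → Σ (Fin n) λ v → ∀ i → V (H (f i)) v

Transversal : ∀ {n} {G : Graph n} {m : ℕ} → (Fin m → Subgraph G) → List (Fin n) → Set
Transversal {m = m} H T = ∀ k → Σ _ λ v → v ∈ T × V (H k) v

{-# OPTIONS --safe #-}
-- Let N be the total of arbitrary weights on H.  Rooting the tree, a common
-- vertex of p members can be moved up to the top of a component of one of them,
-- so counting weighted p-tuples gives N ^ p ≤ p · (d N) · Δ ^ (p - 1), where Δ is
-- the largest weight of the members through one vertex.  With q the least
-- integer such that p d ^ p ≤ q ^ (p - 1), some vertex thus always carries
-- a fraction d / q of the weight.  Multiplicative weights turn this into
-- a multiset of vertices (tokens) of which every member contains more than
-- a fraction d / (q + d), so one of its at most d components contains more than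
-- a fraction 1 / (q + d).  Piercing such subtrees greedily from the leaves up
-- uses disjoint sets of tokens, hence fewer than q + d points.  The additive d
-- of the bound is what lets approximate weights replace LP duality.
module Submission where

open import Defs
open import Data.Nat using (ℕ; zero; suc; _+_; _*_; _^_; _∸_; _≤_; _<_; z≤n; s≤s; _≤?_; _<?_; NonZero; >-nonZero)
open import Data.Fin using (Fin; zero; suc; _≟_; finToFun; funToFin)
open import Data.List using (List; []; _∷_; length; last; map; allFin; deduplicate)
open import Data.List.Relation.Unary.Unique.Propositional using (Unique)
open import Data.Product using (Σ; ∃; _×_; _,_; proj₁; proj₂)
open import Data.Nat.Properties hiding (_≟_)
open import Data.Nat.Tactic.RingSolver using (solve-∀)
open import Algebra.Properties.Semiring.Sum +-*-semiring
  using (sum; ∑-distrib-+; ∑-comm; sum-cong-≗; *-distribˡ-sum; *-distribʳ-sum)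
open import Data.Fin.Properties using (any?; all?; ¬∀⟶∃¬; finToFun-funToFin)
open import Data.List.Extrema.Nat using (argmax; argmax-sel; f[xs]≤f[argmax]; f[⊥]≤f[argmax])
open import Data.List.Membership.DecPropositional using (_∈?_)
open import Data.List.Membership.Propositional using (_∈_)
open import Data.List.Membership.Propositional.Properties using (∈-allFin; ∈-deduplicate⁺)
open import Data.List.Properties using (length-map; length-deduplicate)
open import Data.List.Relation.Unary.All as All using (All; []; _∷_)
open import Data.List.Relation.Unary.All.Properties using (¬Any⇒All¬)
open import Data.List.Relation.Unary.AllPairs using ([]; _∷_)
open import Data.List.Relation.Unary.Any using (here; there)
open import Data.List.Relation.Unary.Unique.DecPropositional.Properties using (deduplicate-!)
open import Data.Maybe using (just)
open import Data.Maybe.Properties using (just-injective)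
open import Data.Sum using (_⊎_; inj₁; inj₂)
import Data.Vec.Functional as Vector
open import Function using (_∘_)
open import Relation.Binary.PropositionalEquality renaming (sym to ≡-sym)
open import Relation.Nullary using (¬_; Dec; yes; no; contradiction)
open import Relation.Nullary.Decidable using (_×-dec_)
open import Relation.Unary using (Decidable)

open ≤-Reasoning hiding (stop)


-- Power inequalities with denominators cleared.

^-distribʳ-* : ∀ x y n → (x * y) ^ n ≡ x ^ n * y ^ n
^-distribʳ-* x y zero = refl
^-distribʳ-* x y (suc n) = trans (cong (x * y *_) (^-distribʳ-* x y n)) (swap x y (x ^ n) (y ^ n))
  where
  swap : ∀ x y u v → x * y * (u * v) ≡ x * u * (y * v)
  swap = solve-∀

^-cancelˡ-≤ : ∀ e x y → x ^ suc e ≤ y ^ suc e → x ≤ y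
^-cancelˡ-≤ e x y le with x ≤? y
... | yes x≤y = x≤y
... | no x≰y = contradiction (<-≤-trans (^-monoˡ-< (suc e) (≰⇒> x≰y)) le) (n≮n _)

-- (1 - x) ^ M * (1 + M x) ≤ 1 with x = d / (D + d), denominators cleared.
bernoulli-minus : ∀ D d M → D ^ M * (D + d + M * d) ≤ (D + d) ^ suc M
bernoulli-minus D d zero = ≤-reflexive (base D d)
  where
  base : ∀ D d → 1 * (D + d + 0 * d) ≡ (D + d) * 1
  base = solve-∀
bernoulli-minus D d (suc M) = begin
  D ^ suc M * (D + d + suc M * d)                   ≡⟨ assoc D d M (D ^ M) ⟩
  D ^ M * (D * (D + d + (d + M * d)))               ≤⟨ *-monoʳ-≤ (D ^ M) (m≤m+n _ (d * d + d * (M * d))) ⟩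
  D ^ M * (D * (D + d + (d + M * d)) + (d * d + d * (M * d)))
                                                    ≡⟨ factor D d M (D ^ M) ⟩
  (D + d) * (D ^ M * (D + d + M * d))               ≤⟨ *-monoʳ-≤ (D + d) (bernoulli-minus D d M) ⟩
  (D + d) ^ suc (suc M)                             ∎
  where
  assoc : ∀ D d M P → D * P * (D + d + (d + M * d)) ≡ P * (D * (D + d + (d + M * d)))
  assoc = solve-∀
  factor : ∀ D d M P → P * (D * (D + d + (d + M * d)) + (d * d + d * (M * d))) ≡ (D + d) * (P * (D + d + M * d))
  factor = solve-∀

-- 1 - d / (1 + b) ≤ (1 - 1 / (1 + b)) ^ d, denominators cleared.
bernoulli-plus : ∀ b d e → suc b ≡ e + d → suc b ^ d * e ≤ suc b * b ^ d
bernoulli-plus b zero e eq = ≤-reflexive (trans (*-identityˡ e) (trans (≡-sym (trans eq (+-identityʳ e))) (≡-sym (*-identityʳ (suc b)))))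
bernoulli-plus b (suc d) e eq = begin
  suc b * suc b ^ d * e      ≡⟨ assoc (suc b) (suc b ^ d) e ⟩
  suc b ^ d * (suc b * e)    ≤⟨ *-monoʳ-≤ (suc b ^ d) shift ⟩
  suc b ^ d * (suc e * b)    ≡⟨ ≡-sym (*-assoc (suc b ^ d) (suc e) b) ⟩
  suc b ^ d * suc e * b      ≤⟨ *-monoˡ-≤ b (bernoulli-plus b d (suc e) (trans eq (+-suc e d))) ⟩
  suc b * b ^ d * b          ≡⟨ assoc′ (suc b) (b ^ d) b ⟩
  suc b * (b * b ^ d)        ∎
  where
  assoc : ∀ x y z → x * y * z ≡ y * (x * z)
  assoc = solve-∀
  assoc′ : ∀ x y z → x * y * z ≡ x * (z * y)
  assoc′ = solve-∀
  expand : ∀ e d → suc (e + d) * e + d ≡ suc e * (e + d)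
  expand = solve-∀
  shift : suc b * e ≤ suc e * b
  shift rewrite suc-injective (trans eq (+-suc e d)) = begin
    suc (e + d) * e      ≤⟨ m≤m+n _ d ⟩
    suc (e + d) * e + d  ≡⟨ expand e d ⟩
    suc e * (e + d)      ∎

-- D is q A - d with A = q + d + 1.
decay-gap : ∀ s d D → let q = suc s in D + suc d ≡ q * suc (q + suc d) →
  D ^ (q + suc d) < q ^ (q + suc d) * (suc (q + suc d) ^ q * (q + suc d) ^ suc d)
decay-gap s d₁ D eq = ≰⇒> absurd
  where
  q d M A z : ℕ
  q = suc s
  d = suc d₁
  M = q + d
  A = suc M
  z = q * A
  reorder : ∀ x y u v → x * (y * (u * v)) ≡ u * (x * (y * v))
  reorder = solve-∀
  reassoc : ∀ x y u v → x * (y * u) * v ≡ x * (y * (u * v))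
  reassoc = solve-∀
  expand : ∀ s d → suc (suc s) * (suc s * suc (suc s + d) + (suc s + d) * d)
                 ≡ suc (suc s + d) * (suc s * suc (suc s + d)) + d * d
  expand = solve-∀
  -- Multiplied together, the two Bernoulli bounds turn the converse into
  -- `suc q * (z + M * d) ≤ A * z`; but the left side equals `A * z + d * d`, and `d` is positive.
  absurd : ¬ (q ^ M * (A ^ q * M ^ d) ≤ D ^ M)
  absurd le = n≮n _ (begin-strict
    A * z                        <⟨ m<m+n (A * z) (s≤s z≤n) ⟩
    A * z + d * d                ≡⟨ ≡-sym (expand s d) ⟩
    suc q * (z + M * d)          ≤⟨ *-cancelˡ-≤ (z ^ M) {{m^n≢0 z M}} scaled ⟩
    A * z                        ∎)
    where
    weighted : z ^ M * suc q ≤ A * D ^ M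
    weighted = begin
      z ^ M * suc q                    ≡⟨ cong (_* suc q) (trans (^-distribʳ-* q A M) (cong (q ^ M *_) (^-distribˡ-+-* A q d))) ⟩
      q ^ M * (A ^ q * A ^ d) * suc q  ≡⟨ reassoc (q ^ M) (A ^ q) (A ^ d) (suc q) ⟩
      q ^ M * (A ^ q * (A ^ d * suc q)) ≤⟨ *-monoʳ-≤ (q ^ M) (*-monoʳ-≤ (A ^ q) (bernoulli-plus M d (suc q) refl)) ⟩
      q ^ M * (A ^ q * (A * M ^ d))    ≡⟨ reorder (q ^ M) (A ^ q) A (M ^ d) ⟩
      A * (q ^ M * (A ^ q * M ^ d))    ≤⟨ *-monoʳ-≤ A le ⟩
      A * D ^ M                        ∎
    scaled : z ^ M * (suc q * (z + M * d)) ≤ z ^ M * (A * z)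
    scaled = begin
      z ^ M * (suc q * (z + M * d))    ≡⟨ ≡-sym (*-assoc (z ^ M) (suc q) _) ⟩
      z ^ M * suc q * (z + M * d)      ≤⟨ *-monoˡ-≤ (z + M * d) weighted ⟩
      A * D ^ M * (z + M * d)          ≡⟨ *-assoc A (D ^ M) _ ⟩
      A * (D ^ M * (z + M * d))        ≤⟨ *-monoʳ-≤ A (subst (λ x → D ^ M * (x + M * d) ≤ x ^ suc M) eq (bernoulli-minus D d M)) ⟩
      A * (z * z ^ M)                  ≡⟨ ≡-sym (*-assoc A z (z ^ M)) ⟩
      A * z * z ^ M                    ≡⟨ *-comm (A * z) (z ^ M) ⟩
      z ^ M * (A * z)                  ∎

-- Bernoulli's inequality `1 + u / y ≤ (1 + 1 / y) ^ u`, denominators cleared.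
bernoulli-suc : ∀ y u → y ^ u * (y + u) ≤ y * suc y ^ u
bernoulli-suc y zero = ≤-reflexive (base y)
  where
  base : ∀ y → 1 * (y + 0) ≡ y * 1
  base = solve-∀
bernoulli-suc y (suc u) = begin
  y * y ^ u * (y + suc u)            ≤⟨ m≤m+n _ (y ^ u * u) ⟩
  y * y ^ u * (y + suc u) + y ^ u * u ≡⟨ factor y u (y ^ u) ⟩
  suc y * (y ^ u * (y + u))          ≤⟨ *-monoʳ-≤ (suc y) (bernoulli-suc y u) ⟩
  suc y * (y * suc y ^ u)            ≡⟨ swap (suc y) y (suc y ^ u) ⟩
  y * (suc y * suc y ^ u)            ∎
  where
  factor : ∀ y u P → y * P * (y + suc u) + P * u ≡ suc y * (P * (y + u))
  factor = solve-∀
  swap : ∀ x y z → x * (y * z) ≡ y * (x * z)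
  swap = solve-∀

geometric-dominates : ∀ {x y} → y < x → ∀ c → ∃ λ u → c * y ^ u < x ^ u
geometric-dominates {x} {zero} 0<x c = 1 , (begin-strict
  c * 0    ≡⟨ *-zeroʳ c ⟩
  0        <⟨ 0<x ⟩
  x        ≡⟨ ≡-sym (*-identityʳ x) ⟩
  x ^ 1    ∎)
geometric-dominates {x} {y@(suc _)} y<x c = u , *-cancelˡ-< y _ _ (begin-strict
  y * (c * y ^ u)      ≡⟨ comm y c (y ^ u) ⟩
  y ^ u * u            <⟨ *-monoʳ-< (y ^ u) {{m^n≢0 y u}} (m<n+m u (s≤s z≤n)) ⟩
  y ^ u * (y + u)      ≤⟨ bernoulli-suc y u ⟩
  y * suc y ^ u        ≤⟨ *-monoʳ-≤ y (^-monoˡ-≤ u y<x) ⟩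
  y * x ^ u            ∎)
  where
  u : ℕ
  -- With this exponent `y * (c * y ^ u)` becomes `y ^ u * u`, which is below the Bernoulli term
  -- `y ^ u * (y + u)`.
  u = c * y
  comm : ∀ y c P → y * (c * P) ≡ P * (c * y)
  comm = solve-∀

-- An integer in place of a real root: `suc s` is the least base whose power reaches `N`. The strict
-- bound on `s` becomes the strict inequality of the theorem.
integer-root : ∀ e N → 0 < N → ∃ λ s → s ^ suc e < N × N ≤ suc s ^ suc e
integer-root e N 0<N = search N (≤-trans (≤-reflexive (≡-sym (*-identityʳ N))) (*-monoʳ-≤ N (m^n>0 N {{>-nonZero 0<N}} e)))
  where
  search : ∀ b → N ≤ b ^ suc e → ∃ λ s → s ^ suc e < N × N ≤ suc s ^ suc e
  search zero N≤0 = contradiction (≤-trans 0<N N≤0) λ ()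
  search (suc b) N≤ with b ^ suc e <? N
  ... | yes lt = b , lt , N≤
  ... | no ≮ = search b (≮⇒≥ ≮)

-- Weighted sums over tuples of members.

sum-mono : ∀ {n} {f g : Fin n → ℕ} → (∀ i → f i ≤ g i) → sum f ≤ sum g
sum-mono {zero} f≤g = z≤n
sum-mono {suc n} f≤g = +-mono-≤ (f≤g zero) (sum-mono (f≤g ∘ suc))

sum-const : ∀ n c → sum {n} (λ _ → c) ≡ n * c
sum-const zero c = refl
sum-const (suc n) c = cong (c +_) (sum-const n c)

term≤sum : ∀ {n} (f : Fin n → ℕ) i → f i ≤ sum f
term≤sum f zero = m≤m+n _ _
term≤sum f (suc i) = ≤-trans (term≤sum (f ∘ suc) i) (m≤n+m _ _)

infix 8 _·_
_·_ : ∀ {n} → (Fin n → ℕ) → (Fin n → ℕ) → ℕ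
y · a = sum (λ k → y k * a k)

-- Weights each `p`-tuple `f` by the product of the `y (f i)`; entries may repeat, as in
-- `PPProperty`.
tupleSum : ∀ {m} p → (Fin m → ℕ) → ((Fin p → Fin m) → ℕ) → ℕ
tupleSum zero y g = g (λ ())
tupleSum (suc p) y g = sum (λ k → y k * tupleSum p y (λ f → g (k Vector.∷ f)))

module _ {m : ℕ} (y : Fin m → ℕ) where

  tupleSum-mono : ∀ p {g h : (Fin p → Fin m) → ℕ} → (∀ f → g f ≤ h f) → tupleSum p y g ≤ tupleSum p y h
  tupleSum-mono zero g≤h = g≤h _
  tupleSum-mono (suc p) g≤h = sum-mono (λ k → *-monoʳ-≤ (y k) (tupleSum-mono p (λ f → g≤h _)))

  tupleSum-one : ∀ p → tupleSum p y (λ _ → 1) ≡ sum y ^ p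
  tupleSum-one zero = refl
  tupleSum-one (suc p) = trans (≡-sym (*-distribʳ-sum (tupleSum p y (λ _ → 1)) y)) (cong (sum y *_) (tupleSum-one p))

  tupleSum-+ : ∀ p (g h : (Fin p → Fin m) → ℕ) →
    tupleSum p y (λ f → g f + h f) ≡ tupleSum p y g + tupleSum p y h
  tupleSum-+ zero g h = refl
  tupleSum-+ (suc p) g h = trans
    (sum-cong-≗ (λ k → trans (cong (y k *_) (tupleSum-+ p (λ f → g (k Vector.∷ f)) (λ f → h (k Vector.∷ f)))) (*-distribˡ-+ (y k) _ _)))
    (∑-distrib-+ (λ k → y k * tupleSum p y (λ f → g (k Vector.∷ f))) (λ k → y k * tupleSum p y (λ f → h (k Vector.∷ f))))

  tupleSum-* : ∀ p c (g : (Fin p → Fin m) → ℕ) →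
    tupleSum p y (λ f → c * g f) ≡ c * tupleSum p y g
  tupleSum-* zero c g = refl
  tupleSum-* (suc p) c g = trans
    (sum-cong-≗ (λ k → trans (cong (y k *_) (tupleSum-* p c (λ f → g (k Vector.∷ f)))) (swap (y k) c _)))
    (≡-sym (*-distribˡ-sum c (λ k → y k * tupleSum p y (λ f → g (k Vector.∷ f)))))
    where
    swap : ∀ a b c → a * (b * c) ≡ b * (a * c)
    swap = solve-∀

  tupleSum-sum : ∀ p {n} (g : Fin n → (Fin p → Fin m) → ℕ) →
    tupleSum p y (λ f → sum (λ v → g v f)) ≡ sum (λ v → tupleSum p y (g v))
  tupleSum-sum zero g = refl
  tupleSum-sum (suc p) g = trans
    (sum-cong-≗ (λ k → trans (cong (y k *_) (tupleSum-sum p (λ v f → g v (k Vector.∷ f))))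
      (*-distribˡ-sum (y k) (λ v → tupleSum p y (λ f → g v (k Vector.∷ f))))))
    (∑-comm (λ k v → y k * tupleSum p y (λ f → g v (k Vector.∷ f))))

  tupleSum-head : ∀ p (c : Fin m → ℕ) (g : (Fin p → Fin m) → ℕ) →
    tupleSum (suc p) y (λ f → c (f zero) * g (f ∘ suc)) ≡ y · c * tupleSum p y g
  tupleSum-head p c g = trans
    (sum-cong-≗ (λ k → trans (cong (y k *_) (tupleSum-* p (c k) g)) (≡-sym (*-assoc (y k) (c k) _))))
    (≡-sym (*-distribʳ-sum (tupleSum p y g) (λ k → y k * c k)))

allOf : ∀ {m} → (Fin m → ℕ) → ∀ p → (Fin p → Fin m) → ℕ
allOf a zero f = 1
allOf a (suc p) f = a (f zero) * allOf a p (f ∘ suc)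

-- The sum over i of b (f i) times the product of a (f i′) over i′ ≢ i.
marked : ∀ {m} → (a b : Fin m → ℕ) → ∀ p → (Fin p → Fin m) → ℕ
marked a b zero f = 0
marked a b (suc p) f = b (f zero) * allOf a p (f ∘ suc) + a (f zero) * marked a b p (f ∘ suc)

allOf-positive : ∀ {m} (a : Fin m → ℕ) p f → (∀ i → 1 ≤ a (f i)) → 1 ≤ allOf a p f
allOf-positive a zero f pos = ≤-refl
allOf-positive a (suc p) f pos = *-mono-≤ (pos zero) (allOf-positive a p (f ∘ suc) (pos ∘ suc))

marked-positive : ∀ {m} (a b : Fin m → ℕ) p f i → 1 ≤ b (f i) → (∀ i → 1 ≤ a (f i)) → 1 ≤ marked a b p f
marked-positive a b (suc p) f zero 1≤b pos =
  ≤-trans (*-mono-≤ 1≤b (allOf-positive a p (f ∘ suc) (pos ∘ suc))) (m≤m+n _ _)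
marked-positive a b (suc p) f (suc i) 1≤b pos =
  ≤-trans (*-mono-≤ (pos zero) (marked-positive a b p (f ∘ suc) i 1≤b (pos ∘ suc))) (m≤n+m _ _)

tupleSum-allOf : ∀ {m} (y a : Fin m → ℕ) p → tupleSum p y (allOf a p) ≡ (y · a) ^ p
tupleSum-allOf y a zero = refl
tupleSum-allOf y a (suc p) = trans (tupleSum-head y p a (allOf a p)) (cong (y · a *_) (tupleSum-allOf y a p))

-- Product weights separate: each of the `suc p` positions, when marked, contributes `y · b` itself
-- and a factor `y · a` from every other position.
tupleSum-marked : ∀ {m} (y a b : Fin m → ℕ) p →
  tupleSum (suc p) y (marked a b (suc p)) ≡ suc p * (y · b * (y · a) ^ p)
tupleSum-marked y a b p = trans
  (tupleSum-+ y (suc p) (λ f → b (f zero) * allOf a p (f ∘ suc)) (λ f → a (f zero) * marked a b p (f ∘ suc)))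
  (trans
    (cong₂ _+_
      (trans (tupleSum-head y p b (allOf a p)) (cong (y · b *_) (tupleSum-allOf y a p)))
      (tupleSum-head y p a (marked a b p)))
    (rest p))
  where
  swap : ∀ p A B P → B * (A * P) + A * (suc p * (B * P)) ≡ suc (suc p) * (B * (A * P))
  swap = solve-∀
  base : ∀ A B → B * 1 + A * 0 ≡ 1 * (B * 1)
  base = solve-∀
  rest : ∀ p → y · b * (y · a) ^ p + y · a * tupleSum p y (marked a b p) ≡ suc p * (y · b * (y · a) ^ p)
  rest zero = base (y · a) (y · b)
  rest (suc p) = trans
    (cong (λ x → y · b * (y · a) ^ suc p + y · a * x) (tupleSum-marked y a b p))
    (swap p (y · a) (y · b) ((y · a) ^ p))

-- Double counting. In use, `a v` indicates the members through `v` and `b v` counts their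
-- components with top `v`. Every tuple is counted at some `v`; the total at `v` is at most
-- `suc p * Δ ^ p` times `y · b v`, and the `y · b v` add up to at most `d * sum y`.
marked-count : ∀ {m n} p d (y : Fin m → ℕ) (a b : Fin n → Fin m → ℕ) →
  (∀ f → ∃ λ v → 1 ≤ marked (a v) (b v) (suc p) f) →
  (∀ k → sum (λ v → b v k) ≤ d) →
  ∀ Δ → (∀ v → y · a v ≤ Δ) →
  sum y ^ suc p ≤ suc p * (d * sum y * Δ ^ p)
marked-count p d y a b covered tops≤d Δ deg≤Δ = begin
  sum y ^ suc p                                                   ≡⟨ ≡-sym (tupleSum-one y (suc p)) ⟩
  tupleSum (suc p) y (λ _ → 1)                                    ≤⟨ tupleSum-mono y (suc p) (λ f → let v , 1≤ = covered f in
                                                                       ≤-trans 1≤ (term≤sum (λ v → marked (a v) (b v) (suc p) f) v)) ⟩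
  tupleSum (suc p) y (λ f → sum (λ v → marked (a v) (b v) (suc p) f)) ≡⟨ tupleSum-sum y (suc p) (λ v → marked (a v) (b v) (suc p)) ⟩
  sum (λ v → tupleSum (suc p) y (marked (a v) (b v) (suc p)))     ≤⟨ sum-mono bound ⟩
  sum (λ v → suc p * Δ ^ p * y · b v)                             ≡⟨ ≡-sym (*-distribˡ-sum (suc p * Δ ^ p) (λ v → y · b v)) ⟩
  suc p * Δ ^ p * sum (λ v → y · b v)                             ≤⟨ *-monoʳ-≤ (suc p * Δ ^ p) total ⟩
  suc p * Δ ^ p * (sum y * d)                                     ≡⟨ reorder (suc p) (Δ ^ p) (sum y) d ⟩
  suc p * (d * sum y * Δ ^ p)                                     ∎
  where
  reorder : ∀ p P N d → p * P * (N * d) ≡ p * (d * N * P)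
  reorder = solve-∀
  swap : ∀ p P B → p * (B * P) ≡ p * P * B
  swap = solve-∀
  bound : ∀ v → tupleSum (suc p) y (marked (a v) (b v) (suc p)) ≤ suc p * Δ ^ p * y · b v
  bound v = begin
    tupleSum (suc p) y (marked (a v) (b v) (suc p)) ≡⟨ tupleSum-marked y (a v) (b v) p ⟩
    suc p * (y · b v * (y · a v) ^ p)               ≤⟨ *-monoʳ-≤ (suc p) (*-monoʳ-≤ (y · b v) (^-monoˡ-≤ p (deg≤Δ v))) ⟩
    suc p * (y · b v * Δ ^ p)                       ≡⟨ swap (suc p) (Δ ^ p) (y · b v) ⟩
    suc p * Δ ^ p * y · b v                         ∎
  total : sum (λ v → y · b v) ≤ sum y * d
  total = begin
    sum (λ v → y · b v)                ≡⟨ ∑-comm (λ v k → y k * b v k) ⟩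
    sum (λ k → sum (λ v → y k * b v k)) ≡⟨ sum-cong-≗ (λ k → ≡-sym (*-distribˡ-sum (y k) (λ v → b v k))) ⟩
    sum (λ k → y k * sum (λ v → b v k)) ≤⟨ sum-mono (λ k → *-monoʳ-≤ (y k) (tops≤d k)) ⟩
    sum (λ k → y k * d)                ≡⟨ ≡-sym (*-distribʳ-sum d y) ⟩
    sum y * d                          ∎

-- Multiplicative weights.

indicator : ∀ {A : Set} → Dec A → ℕ
indicator (yes _) = 1
indicator (no _) = 0

indicator-yes : ∀ {A : Set} (A? : Dec A) → A → 1 ≤ indicator A?
indicator-yes (yes _) a = ≤-refl
indicator-yes (no ¬a) a = contradiction a ¬a

count : ∀ {A : Set} {P : A → Set} → Decidable P → List A → ℕ
count P? [] = 0
count P? (x ∷ xs) = indicator (P? x) + count P? xs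

-- Multiplicative weights: each chosen token multiplies the weight of the sets
-- it hits by M and that of the other sets by A = M + 1.
module MultiplicativeWeights {m n} {P : Fin n → Fin m → Set} (P? : ∀ v k → Dec (P v k))
  (q d M D : ℕ) .{{_ : NonZero M}} (M≡q+d : M ≡ q + d) (D+d≡qA : D + d ≡ q * suc M)
  (gap : D ^ M < q ^ M * (suc M ^ q * M ^ d))
  (oracle : ∀ y → ∃ λ v → d * sum y ≤ q * y · (λ k → indicator (P? v k)))
  where

  A X Y u : ℕ
  A = suc M
  -- Over `M` tokens the total weight gains at most the factor `Y / q ^ M`, whereas a member hit
  -- exactly `d` times gains `A ^ q * M ^ d`, that is `X / q ^ M`. Since `Y < X`, enough such
  -- blocks, `u` of them, absorb the initial total `m`.
  X = q ^ M * (A ^ q * M ^ d)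
  Y = D ^ M
  u = proj₁ (geometric-dominates gap m)

  penalty : ∀ {A : Set} → Dec A → ℕ
  penalty (yes _) = M
  penalty (no _) = A
  penalty-indicator : ∀ {B : Set} (B? : Dec B) → penalty B? + indicator B? ≡ A
  penalty-indicator (yes _) = +-comm M 1
  penalty-indicator (no _) = +-identityʳ A

  weight : List (Fin n) → Fin m → ℕ
  weight [] k = 1
  weight (v ∷ ts) k = weight ts k * penalty (P? v k)

  -- Penalty and indicator add up to `A`, so the old total `N` and the new `N′` satisfy
  -- `N′ + hit = A N`. A hit weight of at least `d N / q` leaves `N′ ≤ (A - d / q) N = (D / q) N`.
  weight-step : ∀ v ts → d * sum (weight ts) ≤ q * weight ts · (λ k → indicator (P? v k)) →
    q * sum (weight (v ∷ ts)) ≤ D * sum (weight ts)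
  weight-step v ts heavy = +-cancelʳ-≤ (d * N) _ _ (begin
    q * N′ + d * N         ≤⟨ +-monoʳ-≤ (q * N′) heavy ⟩
    q * N′ + q * hit       ≡⟨ ≡-sym (*-distribˡ-+ q N′ hit) ⟩
    q * (N′ + hit)         ≡⟨ cong (q *_) split ⟩
    q * (N * A)            ≡⟨ swap q N A ⟩
    q * A * N              ≡⟨ cong (_* N) (≡-sym D+d≡qA) ⟩
    (D + d) * N            ≡⟨ *-distribʳ-+ N D d ⟩
    D * N + d * N          ∎)
    where
    N N′ hit : ℕ
    N = sum (weight ts)
    N′ = sum (weight (v ∷ ts))
    hit = weight ts · (λ k → indicator (P? v k))
    swap : ∀ q N A → q * (N * A) ≡ q * A * N
    swap = solve-∀
    split : N′ + hit ≡ N * A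
    split = trans (≡-sym (∑-distrib-+ (weight (v ∷ ts)) _))
      (trans (sum-cong-≗ (λ k → trans (≡-sym (*-distribˡ-+ (weight ts k) _ _)) (cong (weight ts k *_) (penalty-indicator (P? v k)))))
             (≡-sym (*-distribʳ-sum A (weight ts))))

  play : ∀ t → ∃ λ ts → length ts ≡ t × q ^ t * sum (weight ts) ≤ D ^ t * m
  play zero = [] , refl , ≤-reflexive (cong (1 *_) (trans (sum-const m 1) (*-identityʳ m)))
  play (suc t) with play t
  ... | ts , len , bound with oracle (weight ts)
  ... | v , heavy = v ∷ ts , cong suc len , (begin
    q * q ^ t * sum (weight (v ∷ ts))     ≡⟨ swap q (q ^ t) _ ⟩
    q ^ t * (q * sum (weight (v ∷ ts)))   ≤⟨ *-monoʳ-≤ (q ^ t) (weight-step v ts heavy) ⟩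
    q ^ t * (D * sum (weight ts))         ≡⟨ swap′ (q ^ t) D _ ⟩
    D * (q ^ t * sum (weight ts))         ≤⟨ *-monoʳ-≤ D bound ⟩
    D * (D ^ t * m)                       ≡⟨ ≡-sym (*-assoc D (D ^ t) m) ⟩
    D * D ^ t * m                         ∎)
    where
    swap : ∀ x y z → x * y * z ≡ y * (x * z)
    swap = solve-∀
    swap′ : ∀ x y z → x * (y * z) ≡ y * (x * z)
    swap′ = solve-∀

  hits : List (Fin n) → Fin m → ℕ
  hits ts k = count (λ v → P? v k) ts

  weight-power : ∀ ts k → ∃ λ e → e + hits ts k ≡ length ts × weight ts k ≡ A ^ e * M ^ hits ts k
  weight-power [] k = 0 , refl , refl
  weight-power (v ∷ ts) k with P? v k | weight-power ts k
  ... | yes _ | e , len , eq = e , trans (+-suc e _) (cong suc len) , trans (cong (_* M) eq) (swap (A ^ e) _ M)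
    where
    swap : ∀ x y z → x * y * z ≡ x * (z * y)
    swap = solve-∀
  ... | no _ | e , len , eq = suc e , cong suc len , trans (cong (_* A) eq) (swap (A ^ e) _ A)
    where
    swap : ∀ x y z → x * y * z ≡ z * x * y
    swap = solve-∀

  -- A member hit by at most a fraction `d / M` of the `M * u` tokens would weigh at least
  -- `A ^ (q * u) * M ^ (d * u)`, more than the bound on the total weight allows.
  light-absurd : ∀ k → ¬ (M * hits (proj₁ (play (M * u))) k ≤ d * length (proj₁ (play (M * u))))
  light-absurd k light with play (M * u)
  ... | ts , len , bound with weight-power ts k
  ... | e , e+c , eq = n≮n _ (begin-strict
    X ^ u                            ≡⟨ X^u ⟩
    q ^ (M * u) * (A ^ (q * u) * M ^ (d * u))
                                     ≤⟨ *-monoʳ-≤ (q ^ (M * u)) (≤-trans heavy (term≤sum (weight ts) k)) ⟩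
    q ^ (M * u) * sum (weight ts)    ≤⟨ bound ⟩
    D ^ (M * u) * m                  ≡⟨ trans (*-comm _ m) (cong (m *_) (≡-sym (^-*-assoc D M u))) ⟩
    m * Y ^ u                        <⟨ proj₂ (geometric-dominates gap m) ⟩
    X ^ u                            ∎)
    where
    c g : ℕ
    c = hits ts k
    swap : ∀ x y z → x * (y * z) ≡ y * (x * z)
    swap = solve-∀
    c≤du : c ≤ d * u
    c≤du = *-cancelˡ-≤ M (≤-trans light (≤-reflexive (trans (cong (d *_) len) (swap d M u))))
    -- The shortfall of hits below `d * u`: each is one more miss, which multiplies by `A` in place
    -- of the smaller `M`.
    g = d * u ∸ c
    g+c : g + c ≡ d * u
    g+c = m∸n+n≡m c≤du
    e≡ : e ≡ q * u + g
    e≡ = +-cancelʳ-≡ c e (q * u + g) (trans e+c (trans len (trans (trans (cong (_* u) M≡q+d) (*-distribʳ-+ u q d))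
           (trans (cong (q * u +_) (≡-sym g+c)) (≡-sym (+-assoc (q * u) g c))))))
    X^u : X ^ u ≡ q ^ (M * u) * (A ^ (q * u) * M ^ (d * u))
    X^u = trans (^-distribʳ-* (q ^ M) _ u) (cong₂ _*_ (^-*-assoc q M u)
           (trans (^-distribʳ-* (A ^ q) (M ^ d) u) (cong₂ _*_ (^-*-assoc A q u) (^-*-assoc M d u))))
    heavy : A ^ (q * u) * M ^ (d * u) ≤ weight ts k
    heavy = begin
      A ^ (q * u) * M ^ (d * u)       ≡⟨ cong (λ x → A ^ (q * u) * M ^ x) (≡-sym g+c) ⟩
      A ^ (q * u) * M ^ (g + c)       ≡⟨ cong (A ^ (q * u) *_) (^-distribˡ-+-* M g c) ⟩
      A ^ (q * u) * (M ^ g * M ^ c)   ≤⟨ *-monoʳ-≤ (A ^ (q * u)) (*-monoˡ-≤ (M ^ c) (^-monoˡ-≤ g (n≤1+n M))) ⟩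
      A ^ (q * u) * (A ^ g * M ^ c)   ≡⟨ ≡-sym (*-assoc (A ^ (q * u)) (A ^ g) (M ^ c)) ⟩
      A ^ (q * u) * A ^ g * M ^ c     ≡⟨ cong (_* M ^ c) (≡-sym (^-distribˡ-+-* A (q * u) g)) ⟩
      A ^ (q * u + g) * M ^ c         ≡⟨ cong (λ x → A ^ x * M ^ c) (≡-sym e≡) ⟩
      A ^ e * M ^ c                   ≡⟨ ≡-sym eq ⟩
      weight ts k                     ∎

-- The oracle guarantees the fraction `d / q`. Settling for `d / (q + d)` leaves room for the strict
-- `decay-gap`, so a finite run already yields the tokens.
fractional-cover : ∀ {m n} {P : Fin n → Fin m → Set} (P? : ∀ v k → Dec (P v k)) s d₁ →
  let q = suc s ; d = suc d₁ in
  (∀ y → ∃ λ v → d * sum y ≤ q * y · (λ k → indicator (P? v k))) →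
  ∃ λ ts → ∀ k → d * length ts < (q + d) * count (λ v → P? v k) ts
fractional-cover {m} P? s d₁ oracle = proj₁ (play (M * u)) , λ k → ≰⇒> (light-absurd k)
  where
  M D : ℕ
  M = suc s + suc d₁
  D = suc s * suc M ∸ suc d₁
  D+d≡qA : D + suc d₁ ≡ suc s * suc M
  D+d≡qA = m∸n+n≡m (≤-trans (m≤n+m (suc d₁) (suc (suc s))) (m≤m+n _ _))
  open MultiplicativeWeights P? (suc s) (suc d₁) M D refl D+d≡qA (decay-gap s d₁ D D+d≡qA) oracle

-- Walks in a tree and its rooting.

data WalkIn {n : ℕ} (G : Graph n) (P : Fin n → Set) : Fin n → Fin n → Set where
  stop : ∀ {u} → P u → WalkIn G P u u
  move   : ∀ {u w v} → P u → Adj G u w → WalkIn G P w v → WalkIn G P u v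

module _ {n : ℕ} {G : Graph n} where

  walk-start : ∀ {P u v} → WalkIn G P u v → P u
  walk-start (stop p) = p
  walk-start (move p _ _) = p

  walk-map : ∀ {P Q : Fin n → Set} → (∀ {x} → P x → Q x) → ∀ {u v} → WalkIn G P u v → WalkIn G Q u v
  walk-map f (stop p) = stop (f p)
  walk-map f (move p a W) = move (f p) a (walk-map f W)

  walk-trans : ∀ {P u v w} → WalkIn G P u v → WalkIn G P v w → WalkIn G P u w
  walk-trans (stop _) W′ = W′
  walk-trans (move p a W) W′ = move p a (walk-trans W W′)

  walk-reverse : ∀ {P u v} → WalkIn G P u v → WalkIn G P v u
  walk-reverse (stop p) = stop p
  walk-reverse (move p a W) = walk-trans (walk-reverse W) (move (walk-start W) (sym G a) (stop p))

  SimplePath : (Fin n → Set) → Fin n → List (Fin n) → Set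
  SimplePath P b xs = IsPath G xs × Unique xs × All P xs × last xs ≡ just b

  simplePath-suffix : ∀ {P b a} xs → SimplePath P b xs → a ∈ xs → ∃ λ vs → SimplePath P b (a ∷ vs)
  simplePath-suffix (x ∷ xs) path (here refl) = xs , path
  simplePath-suffix (x ∷ y ∷ ys) (more _ path , _ ∷ unique , _ ∷ all , ends) (there a∈) =
    simplePath-suffix (y ∷ ys) (path , unique , all , ends) a∈

  loop-erase : ∀ {P a b} → WalkIn G P a b → ∃ λ vs → SimplePath P b (a ∷ vs)
  loop-erase (stop p) = [] , one , [] ∷ [] , p ∷ [] , refl
  loop-erase {a = a} (move {w = w} p adj W) with loop-erase W
  ... | vs , simple@(path , unique , all , ends) with _∈?_ _≟_ a (w ∷ vs)
  ... | yes a∈ = simplePath-suffix (w ∷ vs) simple a∈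
  ... | no a∉ = w ∷ vs , more adj path , ¬Any⇒All¬ _ a∉ ∷ unique , p ∷ all , ends

  last-adjacent : ∀ {b u} → Adj G b u → ∀ xs → last xs ≡ just b → LastAdj G u xs
  last-adjacent adj (x ∷ []) refl = lastHere adj
  last-adjacent adj (x ∷ y ∷ ys) ends = lastThere (last-adjacent adj (y ∷ ys) ends)

  -- After loop erasure, a walk with at least two vertices would close up to a cycle through `u`.
  no-detour : Acyclic G → ∀ {u a b} → Adj G u a → Adj G u b → WalkIn G (λ x → u ≢ x) a b → a ≡ b
  no-detour acyclic {u} ua ub W with loop-erase W
  ... | [] , _ , _ , _ , ends = just-injective ends
  ... | v ∷ vs , path , unique , avoids , ends =
    contradiction (more ua path , avoids ∷ unique , s≤s (s≤s (s≤s z≤n)) , last-adjacent (sym G ub) _ ends) (acyclic (u ∷ _ ∷ v ∷ vs))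

  -- The recursion works back from the end of the walk and so meets the last visit to `u` first; `a`
  -- comes right after that visit.
  last-exit : ∀ {v ρ} u → u ≢ ρ → Walk G v ρ →
    WalkIn G (λ x → u ≢ x) v ρ ⊎ (∃ λ a → Adj G u a × WalkIn G (λ x → u ≢ x) a ρ)
  last-exit u u≢ρ nil = inj₁ (stop u≢ρ)
  last-exit {v} u u≢ρ (cons {w = w} adj W) with last-exit u u≢ρ W
  ... | inj₂ exit = inj₂ exit
  ... | inj₁ W′ with u ≟ v
  ... | yes refl = inj₂ (w , adj , W′)
  ... | no u≢v = inj₁ (move u≢v adj W′)

  exit : ∀ {u ρ} → u ≢ ρ → Walk G u ρ → ∃ λ a → Adj G u a × WalkIn G (λ x → u ≢ x) a ρ
  exit {u} u≢ρ W with last-exit u u≢ρ W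
  ... | inj₁ W′ = contradiction refl (walk-start W′)
  ... | inj₂ found = found

  -- The walk is cut at its first visit to `u`, if there is one.
  avoid-or-reach : ∀ {P x z} u → WalkIn G P x z → WalkIn G (λ y → u ≢ y) x z ⊎ WalkIn G P x u
  avoid-or-reach {x = x} u W with u ≟ x
  ... | yes refl = inj₂ (stop (walk-start W))
  avoid-or-reach u (stop p) | no u≢x = inj₁ (stop u≢x)
  avoid-or-reach u (move p adj W) | no u≢x with avoid-or-reach u W
  ... | inj₁ W′ = inj₁ (move u≢x adj W′)
  ... | inj₂ W′ = inj₂ (move p adj W′)

-- `height` is the depth. `height-parent` constrains `parent` only at positive height, so statements
-- that go up to a parent also record `height x ≡ suc a`.
record Rooting {n : ℕ} (G : Graph n) : Set where
  field
    parent : Fin n → Fin n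
    height : Fin n → ℕ

  Child : Fin n → Fin n → Set
  Child u v = parent u ≡ v × height u ≡ suc (height v)

  field
    height-parent : ∀ {u a} → height u ≡ suc a → height (parent u) ≡ a
    edge-child    : ∀ {u v} → Adj G u v → Child u v ⊎ Child v u

tree-rooting : ∀ {n} {G : Graph n} → IsTree G → Fin n → Rooting G
tree-rooting {n} {G} (connected , acyclic) ρ = record
  { parent = parent
  ; height = height
  ; height-parent = height-parent
  ; edge-child = λ adj → edge-child adj
  }
  where
  parent : Fin n → Fin n
  parent u with u ≟ ρ
  ... | yes _ = ρ
  -- The neighbour through which the walk to `ρ` leaves `u` for the last time.
  ... | no u≢ρ = proj₁ (exit u≢ρ (connected u ρ))

  parent-exit : ∀ {u} → u ≢ ρ → Adj G u (parent u) × WalkIn G (λ x → u ≢ x) (parent u) ρ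
  parent-exit {u} u≢ρ with u ≟ ρ
  ... | yes u≡ρ = contradiction u≡ρ u≢ρ
  ... | no u≢ρ′ = proj₂ (exit u≢ρ′ (connected u ρ))

  edge′ : ∀ {u v} → Dec (u ≡ ρ) → Dec (v ≡ ρ) → Adj G u v →
    (u ≢ ρ × parent u ≡ v) ⊎ (v ≢ ρ × parent v ≡ u)
  edge′ (yes refl) (yes refl) adj = contradiction adj (irrefl G)
  edge′ (yes refl) (no v≢ρ) adj = let va , W = parent-exit v≢ρ in
    inj₂ (v≢ρ , no-detour acyclic va (sym G adj) W)
  edge′ (no u≢ρ) (yes refl) adj = let ua , W = parent-exit u≢ρ in
    inj₁ (u≢ρ , no-detour acyclic ua adj W)
  -- If the walk from `parent v` to `ρ` avoids `u`, it joins with the one from `parent u` to lead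
  -- from `parent u` to `v` without `u`, which forces `parent u ≡ v`. Otherwise its initial part
  -- leads from `parent v` to `u` without `v`.
  edge′ {u} {v} (no u≢ρ) (no v≢ρ) adj with parent-exit u≢ρ | parent-exit v≢ρ
  ... | ua , U | va , W with avoid-or-reach u W
  ... | inj₁ W′ = inj₁ (u≢ρ , no-detour acyclic ua adj (walk-trans U (walk-reverse (move u≢v va W′))))
    where
    u≢v : u ≢ v
    u≢v refl = irrefl G adj
  ... | inj₂ W′ = inj₂ (v≢ρ , no-detour acyclic va (sym G adj) W′)

  edge : ∀ {u v} → Adj G u v → (u ≢ ρ × parent u ≡ v) ⊎ (v ≢ ρ × parent v ≡ u)
  edge {u} {v} = edge′ (u ≟ ρ) (v ≟ ρ)

  -- Certifies that iterating `parent` reaches `ρ`. Its length depends on the vertex alone, so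
  -- `height` is independent of the walks that connectedness supplies.
  data Ascent : Fin n → Set where
    root : Ascent ρ
    up   : ∀ {u} → u ≢ ρ → Ascent (parent u) → Ascent u

  steps : ∀ {u} → Ascent u → ℕ
  steps root = 0
  steps (up _ A) = suc (steps A)

  steps-unique : ∀ {u} (A B : Ascent u) → steps A ≡ steps B
  steps-unique root root = refl
  steps-unique root (up ρ≢ρ _) = contradiction refl ρ≢ρ
  steps-unique (up ρ≢ρ _) root = contradiction refl ρ≢ρ
  steps-unique (up _ A) (up _ B) = cong suc (steps-unique A B)

  ascent : ∀ {u} → Walk G u ρ → Ascent u
  ascent nil = root
  -- Each edge leads to a parent or comes down from one, so the ascent gains or loses one step.
  ascent (cons adj W) with ascent W | edge adj
  ... | A | inj₁ (u≢ρ , refl) = up u≢ρ A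
  ... | root | inj₂ (ρ≢ρ , _) = contradiction refl ρ≢ρ
  ... | up _ A | inj₂ (_ , refl) = A

  height : Fin n → ℕ
  height u = steps (ascent (connected u ρ))

  height-up : ∀ {u} → u ≢ ρ → height u ≡ suc (height (parent u))
  height-up {u} u≢ρ = steps-unique (ascent (connected u ρ)) (up u≢ρ (ascent (connected (parent u) ρ)))

  height-root : height ρ ≡ 0
  height-root = steps-unique (ascent (connected ρ ρ)) root

  height-parent : ∀ {u a} → height u ≡ suc a → height (parent u) ≡ a
  height-parent {u} {a} eq = by-cases (u ≟ ρ)
    where
    by-cases : Dec (u ≡ ρ) → height (parent u) ≡ a
    by-cases (yes u≡ρ) = contradiction (trans (≡-sym eq) (trans (cong height u≡ρ) height-root)) λ ()
    by-cases (no u≢ρ) = suc-injective (trans (≡-sym (height-up u≢ρ)) eq)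

  edge-child : ∀ {u v} → Adj G u v →
    (parent u ≡ v × height u ≡ suc (height v)) ⊎ (parent v ≡ u × height v ≡ suc (height u))
  edge-child adj with edge adj
  ... | inj₁ (u≢ρ , refl) = inj₁ (refl , height-up u≢ρ)
  ... | inj₂ (v≢ρ , refl) = inj₂ (refl , height-up v≢ρ)

-- Counting, removing and moving tokens.

indicator-no : ∀ {A : Set} (A? : Dec A) → ¬ A → indicator A? ≡ 0
indicator-no (yes a) ¬a = contradiction a ¬a
indicator-no (no _) ¬a = refl

indicator-mono : ∀ {A B : Set} (A? : Dec A) (B? : Dec B) → (A → B) → indicator A? ≤ indicator B?
indicator-mono (yes a) B? f = indicator-yes B? (f a)
indicator-mono (no _) B? f = z≤n

sum-indicator-≟ : ∀ {n} (x : Fin n) → sum (λ v → indicator (x ≟ v)) ≤ 1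
sum-indicator-≟ {suc n} zero = s≤s (≤-reflexive (trans (sum-const n 0) (*-zeroʳ n)))
sum-indicator-≟ {suc n} (suc x) =
  ≤-trans (sum-mono (λ v → indicator-mono (suc x ≟ suc v) (x ≟ v) λ { refl → refl })) (sum-indicator-≟ x)

count-mono : ∀ {A : Set} {P Q : A → Set} (P? : Decidable P) (Q? : Decidable Q) xs →
  All (λ x → P x → Q x) xs → count P? xs ≤ count Q? xs
count-mono P? Q? [] [] = z≤n
count-mono P? Q? (x ∷ xs) (f ∷ fs) = +-mono-≤ (indicator-mono (P? x) (Q? x) f) (count-mono P? Q? xs fs)

count-cover : ∀ {A : Set} {P : A → Set} {d} {Q : Fin d → A → Set} (P? : Decidable P) (Q? : ∀ j → Decidable (Q j)) →
  (∀ x → P x → ∃ λ j → Q j x) → ∀ xs → count P? xs ≤ sum (λ j → count (Q? j) xs)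
count-cover P? Q? cover [] = z≤n
count-cover P? Q? cover (x ∷ xs) = ≤-trans
  (+-mono-≤ head (count-cover P? Q? cover xs))
  (≤-reflexive (≡-sym (∑-distrib-+ (λ j → indicator (Q? j x)) (λ j → count (Q? j) xs))))
  where
  head : indicator (P? x) ≤ sum (λ j → indicator (Q? j x))
  head with P? x
  ... | no _ = z≤n
  ... | yes p = let j , q = cover x p in
    ≤-trans (indicator-yes (Q? j x) q) (term≤sum (λ j → indicator (Q? j x)) j)

module _ {n : ℕ} where

  remove : Fin n → List (Fin n) → List (Fin n)
  remove u [] = []
  remove u (x ∷ xs) with u ≟ x
  ... | yes _ = remove u xs
  ... | no _ = x ∷ remove u xs

  length-remove : ∀ u xs → count (u ≟_) xs + length (remove u xs) ≡ length xs
  length-remove u [] = refl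
  length-remove u (x ∷ xs) with u ≟ x
  ... | yes _ = cong suc (length-remove u xs)
  ... | no _ = trans (+-suc _ _) (cong suc (length-remove u xs))

  count-remove : ∀ {P : Fin n → Set} (P? : Decidable P) u xs → ¬ P u → count P? xs ≤ count P? (remove u xs)
  count-remove P? u [] ¬pu = z≤n
  count-remove P? u (x ∷ xs) ¬pu with u ≟ x
  ... | yes refl = ≤-trans (≤-reflexive (cong (_+ count P? xs) (indicator-no (P? u) ¬pu))) (count-remove P? u xs ¬pu)
  ... | no _ = +-monoʳ-≤ (indicator (P? x)) (count-remove P? u xs ¬pu)

  redirect : Fin n → Fin n → Fin n → Fin n
  redirect u v x with u ≟ x
  ... | yes _ = v
  ... | no _ = x

  count-redirect : ∀ {P : Fin n → Set} (P? : Decidable P) u v xs → (P u → P v) →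
    count P? xs ≤ count P? (map (redirect u v) xs)
  count-redirect P? u v [] pu⇒pv = z≤n
  count-redirect P? u v (x ∷ xs) pu⇒pv with u ≟ x
  ... | yes refl = +-mono-≤ (indicator-mono (P? u) (P? v) pu⇒pv) (count-redirect P? u v xs pu⇒pv)
  ... | no _ = +-monoʳ-≤ (indicator (P? x)) (count-redirect P? u v xs pu⇒pv)

  module _ (h : Fin n → ℕ) where

    -- Termination measure of the piercing: moving tokens up lowers `h`, and `suc` makes the removal
    -- of a token at height 0 count as well.
    potential : List (Fin n) → ℕ
    potential [] = 0
    potential (x ∷ xs) = suc (h x) + potential xs

    potential-remove-≤ : ∀ u xs → potential (remove u xs) ≤ potential xs
    potential-remove-≤ u [] = z≤n
    potential-remove-≤ u (x ∷ xs) with u ≟ x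
    ... | yes _ = ≤-trans (potential-remove-≤ u xs) (m≤n+m _ _)
    ... | no _ = +-monoʳ-≤ (suc (h x)) (potential-remove-≤ u xs)

    potential-remove-< : ∀ u xs → u ∈ xs → potential (remove u xs) < potential xs
    potential-remove-< u (x ∷ xs) u∈ with u ≟ x
    ... | yes _ = s≤s (≤-trans (potential-remove-≤ u xs) (m≤n+m _ _))
    potential-remove-< u (x ∷ xs) (here u≡x) | no u≢x = contradiction u≡x u≢x
    potential-remove-< u (x ∷ xs) (there u∈) | no _ = +-monoʳ-< (suc (h x)) (potential-remove-< u xs u∈)

    potential-redirect-≤ : ∀ u v xs → h v ≤ h u → potential (map (redirect u v) xs) ≤ potential xs
    potential-redirect-≤ u v [] hv≤ = z≤n
    potential-redirect-≤ u v (x ∷ xs) hv≤ with u ≟ x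
    ... | yes refl = +-mono-≤ (s≤s hv≤) (potential-redirect-≤ u v xs hv≤)
    ... | no _ = +-monoʳ-≤ (suc (h x)) (potential-redirect-≤ u v xs hv≤)

    potential-redirect-< : ∀ u v xs → h v < h u → u ∈ xs → potential (map (redirect u v) xs) < potential xs
    potential-redirect-< u v (x ∷ xs) hv< u∈ with u ≟ x
    ... | yes refl = +-mono-<-≤ (s≤s hv<) (potential-redirect-≤ u v xs (<⇒≤ hv<))
    potential-redirect-< u v (x ∷ xs) hv< (here u≡x) | no u≢x = contradiction u≡x u≢x
    potential-redirect-< u v (x ∷ xs) hv< (there u∈) | no _ =
      +-monoʳ-< (suc (h x)) (potential-redirect-< u v xs hv< u∈)

-- Subtrees of the rooted tree and greedy piercing.

module RootedTree {n : ℕ} {G : Graph n} (R : Rooting G) where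
  open Rooting R

  -- A subtree hanging from `t`, encoded by closure under parents except at `t`.
  RootedSubtree : (Fin n → Set) → Fin n → Set
  RootedSubtree P t = ∀ x → P x → x ≡ t ⊎ (∃ λ a → height x ≡ suc a × P (parent x))

  above-root : ∀ {P t} → RootedSubtree P t → ∀ h x → height x ≡ h → P x → x ≢ t → height t < height x
  above-root {P} {t} sub h x eq px x≢t with sub x px
  ... | inj₁ x≡t = contradiction x≡t x≢t
  above-root {P} {t} sub zero x eq px x≢t | inj₂ (a , eq′ , _) = contradiction (trans (≡-sym eq) eq′) λ ()
  above-root {P} {t} sub (suc h) x eq px x≢t | inj₂ (a , eq′ , pp) with parent x ≟ t
  ... | yes refl = ≤-reflexive (trans (cong suc (height-parent eq)) (≡-sym eq))
  ... | no ≢t = <-trans (above-root sub h (parent x) (height-parent eq) pp ≢t)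
                  (≤-reflexive (trans (cong suc (height-parent eq)) (≡-sym eq)))

  module _ {P : Fin n → Set} (P? : Decidable P) where

    -- The first argument is fuel. Fuel `height u` allows every step to the root, so `top u` is the
    -- highest vertex reached from `u` through parents in `P`.
    climb : ℕ → Fin n → Fin n
    climb zero u = u
    climb (suc h) u with P? (parent u)
    ... | yes _ = climb h (parent u)
    ... | no _ = u

    top : Fin n → Fin n
    top u = climb (height u) u

    top-cases : ∀ u → top u ≡ u ⊎ (∃ λ a → height u ≡ suc a × P (parent u) × top u ≡ top (parent u))
    top-cases u = go (height u) refl
      where
      go : ∀ h → height u ≡ h → climb h u ≡ u ⊎ (∃ λ a → height u ≡ suc a × P (parent u) × climb h u ≡ top (parent u))
      go zero eq = inj₁ refl
      go (suc h) eq with P? (parent u)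
      ... | yes p = inj₂ (h , eq , p , cong (λ a → climb a (parent u)) (≡-sym (height-parent eq)))
      ... | no _ = inj₁ refl

    top-child : ∀ {u v} → Child u v → P v → top u ≡ top v
    top-child {u} {v} (refl , eq) pv = trans (cong (λ a → climb a u) eq) go
      where
      go : climb (suc (height v)) u ≡ top v
      go with P? (parent u)
      ... | yes _ = refl
      ... | no ¬pv = contradiction pv ¬pv

    -- Each edge of the walk joins a child to its parent inside `P`, so `top` can label the
    -- components of `P`.
    top-walk : ∀ {u v} → WalkIn G P u v → top u ≡ top v
    top-walk (stop _) = refl
    top-walk (move pu adj W) with edge-child adj
    ... | inj₁ child = trans (top-child child (walk-start W)) (top-walk W)
    ... | inj₂ child = trans (≡-sym (top-child child pu)) (top-walk W)

    component-rooted : ∀ t → RootedSubtree (λ x → P x × top x ≡ t) t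
    component-rooted t x (px , top≡t) with top-cases x
    ... | inj₁ fixed = inj₁ (trans (≡-sym fixed) top≡t)
    ... | inj₂ (a , eq , pp , same) = inj₂ (a , eq , pp , trans (≡-sym same) top≡t)

  -- Climb inside the intersection: where this stops, the parent leaves some P i.
  common-top : ∀ {p} {P : Fin (suc p) → Fin n → Set} (P? : ∀ i → Decidable (P i)) h v → height v ≡ h →
    (∀ i → P i v) → ∃ λ u → (∀ i → P i u) × ∃ λ i → top (P? i) u ≡ u
  -- At height 0 every climb stops at once, so any index serves.
  common-top P? zero v eq pv = v , pv , zero , cong (λ a → climb (P? zero) a v) eq
  common-top {P = P} P? (suc h) v eq pv with all? (λ i → P? i (parent v))
  ... | yes pp = common-top P? h (parent v) (height-parent eq) pp
  ... | no ¬pp with ¬∀⟶∃¬ _ (λ i → P i (parent v)) (λ i → P? i (parent v)) ¬pp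
  ... | i , ¬p with top-cases (P? i) v
  ... | inj₁ fixed = v , pv , i , fixed
  ... | inj₂ (_ , _ , p , _) = contradiction p ¬p

  -- The deepest token position u either is heavy, and becomes a piercing point,
  -- or passes its tokens to its parent.  In the latter case a heavy subtree
  -- containing u also contains the parent of u: otherwise u would be its root
  -- and would carry all of its tokens.
  module Piercing (t₀ M : ℕ) where

    -- `t₀` stays fixed while tokens disappear: heavy means more than `t₀ / M` tokens, and each
    -- point of `T` uses up that many.
    Pierced : List (Fin n) → Set₁
    Pierced ts = ∃ λ T → suc t₀ * length T ≤ M * length ts ×
      (∀ {P} (P? : Decidable P) t → RootedSubtree P t → t₀ < M * count P? ts → ∃ λ v → v ∈ T × P v)

    root-light : ∀ {P} (P? : Decidable P) {t} u ts → All (λ x → height x ≤ height u) ts →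
      ¬ (t₀ < M * count (u ≟_) ts) → RootedSubtree P t → t₀ < M * count P? ts → u ≢ t
    root-light P? u ts deepest light sub heavy refl =
      light (<-≤-trans heavy (*-monoʳ-≤ M (count-mono P? (u ≟_) ts (All.map only-root deepest))))
      where
      only-root : ∀ {x} → height x ≤ height u → _ → u ≡ x
      only-root {x} hx≤hu px with u ≟ x
      ... | yes u≡x = u≡x
      ... | no u≢x = contradiction (<-≤-trans (above-root sub _ x refl px (u≢x ∘ ≡-sym)) hx≤hu) (n≮n _)

    deepest : ∀ x xs → ∃ λ u → u ∈ x ∷ xs × All (λ y → height y ≤ height u) (x ∷ xs)
    deepest x xs = argmax height x xs , member , f[⊥]≤f[argmax] {f = height} x xs ∷ f[xs]≤f[argmax] {f = height} x xs
      where
      member : argmax height x xs ∈ x ∷ xs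
      member with argmax-sel height x xs
      ... | inj₁ eq = here eq
      ... | inj₂ u∈ = there u∈

    pierce : ∀ fuel ts → potential height ts ≤ fuel → Pierced ts
    pierce fuel [] _ = [] , ≤-reflexive (trans (*-zeroʳ (suc t₀)) (≡-sym (*-zeroʳ M))) ,
      λ P? t sub heavy → contradiction (≤-trans heavy (≤-reflexive (*-zeroʳ M))) λ ()
    pierce (suc fuel) ts@(x ∷ xs) (s≤s bound) with deepest x xs
    ... | u , u∈ , deep with t₀ <? M * count (u ≟_) ts
    -- Subtrees through `u` are pierced by it; the others lose no token in the removal and stay
    -- heavy.
    ... | yes heavy-u = pick (pierce fuel (remove u ts) (≤-pred (≤-trans (potential-remove-< height u ts u∈) (s≤s bound))))
      where
      pick : Pierced (remove u ts) → Pierced ts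
      pick (T , size , hit) = u ∷ T , (begin
        suc t₀ * suc (length T)                              ≡⟨ *-suc (suc t₀) (length T) ⟩
        suc t₀ + suc t₀ * length T                           ≤⟨ +-mono-≤ heavy-u size ⟩
        M * count (u ≟_) ts + M * length (remove u ts)       ≡⟨ ≡-sym (*-distribˡ-+ M (count (u ≟_) ts) _) ⟩
        M * (count (u ≟_) ts + length (remove u ts))         ≡⟨ cong (M *_) (length-remove u ts) ⟩
        M * length ts                                        ∎) , hit′
        where
        hit′ : ∀ {P} (P? : Decidable P) t → RootedSubtree P t → t₀ < M * count P? ts → ∃ λ v → v ∈ u ∷ T × P v
        hit′ P? t sub heavy with P? u
        ... | yes pu = u , here refl , pu
        ... | no ¬pu = let v , v∈ , pv = hit P? t sub (<-≤-trans heavy (*-monoʳ-≤ M (count-remove P? u ts ¬pu))) in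
          v , there v∈ , pv
    ... | no light = pass (height u) refl
      where
      pass : ∀ h → height u ≡ h → Pierced ts
      pass zero eq with pierce fuel (remove u ts) (≤-pred (≤-trans (potential-remove-< height u ts u∈) (s≤s bound)))
      ... | T , size , hit = T , ≤-trans size (*-monoʳ-≤ M (≤-trans (m≤n+m _ _) (≤-reflexive (length-remove u ts)))) , hit′
        where
        hit′ : ∀ {P} (P? : Decidable P) t → RootedSubtree P t → t₀ < M * count P? ts → ∃ λ v → v ∈ T × P v
        hit′ {P} P? t sub heavy = hit P? t sub (<-≤-trans heavy (*-monoʳ-≤ M (count-remove P? u ts ¬pu)))
          where
          ¬pu : ¬ P u
          ¬pu pu with sub u pu
          ... | inj₁ u≡t = root-light P? u ts deep light sub heavy u≡t
          ... | inj₂ (_ , eq′ , _) = contradiction (trans (≡-sym eq) eq′) λ ()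
      pass (suc h) eq with pierce fuel (map (redirect u (parent u)) ts)
        (≤-pred (≤-trans (potential-redirect-< height u (parent u) ts
          (≤-reflexive (trans (cong suc (height-parent eq)) (≡-sym eq))) u∈) (s≤s bound)))
      ... | T , size , hit = T , ≤-trans size (≤-reflexive (cong (M *_) (length-map _ ts))) , hit′
        where
        hit′ : ∀ {P} (P? : Decidable P) t → RootedSubtree P t → t₀ < M * count P? ts → ∃ λ v → v ∈ T × P v
        hit′ {P} P? t sub heavy = hit P? t sub (<-≤-trans heavy (*-monoʳ-≤ M (count-redirect P? u (parent u) ts up)))
          where
          up : P u → P (parent u)
          up pu with sub u pu
          ... | inj₁ u≡t = contradiction u≡t (root-light P? u ts deep light sub heavy)
          ... | inj₂ (_ , _ , pp) = pp

-- Heavy vertices, heavy components and the size bound.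

cancel-weights : ∀ e p d q N Δ → N ^ suc (suc e) ≤ p * (d * N * Δ ^ suc e) →
  p * d ^ suc (suc e) ≤ q ^ suc e → d * N ≤ q * Δ
cancel-weights e p d q zero Δ _ _ = ≤-trans (≤-reflexive (*-zeroʳ d)) z≤n
-- A positive `N` cancels once, and `root≤` turns the rest into a comparison of `suc e`-th powers.
cancel-weights e p d q N@(suc _) Δ count≤ root≤ = ^-cancelˡ-≤ e (d * N) (q * Δ) (begin
  (d * N) ^ suc e                      ≡⟨ ^-distribʳ-* d N (suc e) ⟩
  d ^ suc e * N ^ suc e                ≤⟨ *-monoʳ-≤ (d ^ suc e) (*-cancelˡ-≤ N (≤-trans count≤ (≤-reflexive (pull p d N (Δ ^ suc e))))) ⟩
  d ^ suc e * (p * (d * Δ ^ suc e))    ≡⟨ gather (d ^ suc e) p d (Δ ^ suc e) ⟩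
  p * (d * d ^ suc e) * Δ ^ suc e      ≤⟨ *-monoˡ-≤ (Δ ^ suc e) root≤ ⟩
  q ^ suc e * Δ ^ suc e                ≡⟨ ≡-sym (^-distribʳ-* q Δ (suc e)) ⟩
  (q * Δ) ^ suc e                      ∎)
  where
  pull : ∀ p d N P → p * (d * N * P) ≡ N * (p * (d * P))
  pull = solve-∀
  gather : ∀ x p d y → x * (p * (d * y)) ≡ p * (d * x) * y
  gather = solve-∀

module Family {n m d : ℕ} {G : Graph n} (R : Rooting G) {P : Fin m → Fin n → Set} (P? : ∀ k → Decidable (P k))
  (r : Fin m → Fin d → Fin n) (connected : ∀ k v → P k v → ∃ λ j → WalkIn G (P k) (r k j) v) where
  open Rooting R
  open RootedTree R

  -- Counts indices `j`, not distinct components: a component may be counted repeatedly, yet the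
  -- total over `v` is still at most `d`.
  tops : Fin n → Fin m → ℕ
  tops v k = sum (λ j → indicator (top (P? k) (r k j) ≟ v))

  member : Fin n → Fin m → ℕ
  member v k = indicator (P? k v)

  tops-total : ∀ k → sum (λ v → tops v k) ≤ d
  tops-total k = begin
    sum (λ v → tops v k)                                              ≡⟨ ∑-comm (λ v j → indicator (top (P? k) (r k j) ≟ v)) ⟩
    sum (λ j → sum (λ v → indicator (top (P? k) (r k j) ≟ v)))        ≤⟨ sum-mono (λ j → sum-indicator-≟ (top (P? k) (r k j))) ⟩
    sum {d} (λ _ → 1)                                                 ≡⟨ trans (sum-const d 1) (*-identityʳ d) ⟩
    d                                                                 ∎

  tops-positive : ∀ {k u} → P k u → top (P? k) u ≡ u → 1 ≤ tops u k
  tops-positive {k} {u} pu fixed = let j , W = connected k u pu in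
    ≤-trans (indicator-yes (top (P? k) (r k j) ≟ u) (trans (top-walk (P? k) W) fixed))
            (term≤sum (λ j → indicator (top (P? k) (r k j) ≟ u)) j)

  -- By `common-top`, a common vertex of a tuple can be moved up to a top of one of its members,
  -- where `marked` is positive; `marked-count` then applies with `Δ` the largest weight at a
  -- vertex.
  heavy-vertex : ∀ e q → (∀ (f : Fin (suc (suc e)) → Fin m) → ∃ λ v → ∀ i → P (f i) v) → Fin n →
    suc (suc e) * d ^ suc (suc e) ≤ q ^ suc e →
    ∀ y → ∃ λ v → d * sum y ≤ q * y · member v
  heavy-vertex e q common v₀ root≤ y =
    v* , cancel-weights e (suc (suc e)) d q (sum y) (y · member v*)
      (marked-count (suc e) d y member tops covered tops-total (y · member v*) maximal) root≤
    where
    v* : Fin n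
    v* = argmax (λ v → y · member v) v₀ (allFin n)
    maximal : ∀ v → y · member v ≤ y · member v*
    maximal v = All.lookup (f[xs]≤f[argmax] {f = λ v → y · member v} v₀ (allFin n)) (∈-allFin v)
    covered : ∀ f → ∃ λ v → 1 ≤ marked (member v) (tops v) (suc (suc e)) f
    covered f with common f
    ... | v , pv with common-top (λ i → P? (f i)) (height v) v refl pv
    ... | u , pu , i , fixed = u , marked-positive (member u) (tops u) (suc (suc e)) f i
      (tops-positive (pu i) fixed) (λ i → indicator-yes (P? (f i) u) (pu i))

  -- Identified by its top rather than by walks, which makes it decidable and lets
  -- `component-rooted` apply.
  Component : ∀ k → Fin d → Fin n → Set
  Component k j x = P k x × top (P? k) x ≡ top (P? k) (r k j)

  component? : ∀ k j → Decidable (Component k j)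
  component? k j x = P? k x ×-dec (top (P? k) x ≟ top (P? k) (r k j))

  heavy-component : ∀ M k ts → d * length ts < M * count (P? k) ts →
    ∃ λ j → length ts < M * count (component? k j) ts
  heavy-component M k ts heavy with any? (λ j → length ts <? M * count (component? k j) ts)
  ... | yes found = found
  ... | no none = contradiction heavy (≤⇒≯ (begin
    M * count (P? k) ts                                ≤⟨ *-monoʳ-≤ M (count-cover (P? k) (component? k) cover ts) ⟩
    M * sum (λ j → count (component? k j) ts)          ≡⟨ *-distribˡ-sum M (λ j → count (component? k j) ts) ⟩
    sum (λ j → M * count (component? k j) ts)          ≤⟨ sum-mono (λ j → ≮⇒≥ (λ lt → none (j , lt))) ⟩
    sum {d} (λ _ → length ts)                          ≡⟨ sum-const d (length ts) ⟩
    d * length ts                                      ∎))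
    where
    cover : ∀ x → P k x → ∃ λ j → Component k j x
    cover x px = let j , W = connected k x px in j , px , ≡-sym (top-walk (P? k) W)

  -- Piercing runs with threshold `L = length ts`, so heavy means more than `L / M` tokens. Its size
  -- bound `(L + 1) * length T ≤ M * L` excludes `M ≤ length T`.
  round : ∀ M ts → 1 ≤ M → (∀ k → d * length ts < M * count (P? k) ts) →
    ∃ λ T → length T < M × (∀ k → ∃ λ v → v ∈ T × P k v)
  round M ts 1≤M heavy with Piercing.pierce (length ts) M (potential height ts) ts ≤-refl
  ... | T , size , hit = T , ≰⇒> small , pierced
    where
    small : ¬ (M ≤ length T)
    small M≤T = n≮n _ (begin-strict
      M * length ts                ≡⟨ *-comm M (length ts) ⟩
      length ts * M                <⟨ m<n+m _ 1≤M ⟩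
      suc (length ts) * M          ≤⟨ *-monoʳ-≤ (suc (length ts)) M≤T ⟩
      suc (length ts) * length T   ≤⟨ size ⟩
      M * length ts                ∎)
    pierced : ∀ k → ∃ λ v → v ∈ T × P k v
    pierced k with heavy-component M k ts (heavy k)
    ... | j , heavy-j with hit (component? k j) (top (P? k) (r k j)) (component-rooted (P? k) _) heavy-j
    ... | v , v∈T , pv , _ = v , v∈T , pv

positive-bound : ∀ p d → 0 < suc p * suc d ^ suc p
positive-bound p d = *-mono-≤ {1} {suc p} (s≤s z≤n) (m^n>0 (suc d) (suc p))

-- With `q = suc s` from `integer-root`, fewer than `q + d` points means an excess over `d` of at
-- most `s`, whose power is below `p * d ^ p` by the minimality of `q`.
transversal-bound : ∀ {n m d₁ : ℕ} {G : Graph n} → Rooting G → {P : Fin m → Fin n → Set} (P? : ∀ k → Decidable (P k))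
  (r : Fin m → Fin (suc d₁) → Fin n) → (∀ k v → P k v → ∃ λ j → WalkIn G (P k) (r k j) v) →
  ∀ e → (∀ (f : Fin (suc (suc e)) → Fin m) → ∃ λ v → ∀ i → P (f i) v) → Fin n →
  ∃ λ T → (∀ k → ∃ λ v → v ∈ T × P k v) × (length T ∸ suc d₁) ^ suc e < suc (suc e) * suc d₁ ^ suc (suc e)
transversal-bound {d₁ = d₁} R P? r connected e common v₀ =
  let s , s^<N , N≤q^ = integer-root e _ (positive-bound (suc e) d₁)
      ts , heavy = fractional-cover (λ v k → P? k v) s d₁ (heavy-vertex e (suc s) common v₀ N≤q^)
      T , size , hits = round (suc s + suc d₁) ts (s≤s z≤n) heavy
  in T , hits , ≤-<-trans (^-monoˡ-≤ (suc e) (excess s (length T) size)) s^<N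
  where
  open Family R P? r connected
  excess : ∀ s l → l < suc s + suc d₁ → l ∸ suc d₁ ≤ s
  excess s l (s≤s l≤) = ≤-trans (∸-monoˡ-≤ (suc d₁) l≤) (≤-reflexive (m+n∸n≡m s (suc d₁)))

-- Reduction to decidable members, and the theorem.

module _ {n : ℕ} {G : Graph n} {S : Subgraph G} where

  vertices : ∀ {u v} → Reach S u v → List (Fin n)
  vertices {u} (here _) = u ∷ []
  vertices {u} (step _ W) = u ∷ vertices W

  vertices-V : ∀ {u v x} (W : Reach S u v) → x ∈ vertices W → V S x
  vertices-V (here p) (here refl) = p
  vertices-V (step uw W) (here refl) = proj₁ (E-V S uw)
  vertices-V (step uw W) (there x∈) = vertices-V W x∈

  end∈vertices : ∀ {u v} (W : Reach S u v) → v ∈ vertices W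
  end∈vertices (here _) = here refl
  end∈vertices (step _ W) = there (end∈vertices W)

  vertices-walk : ∀ {u v x} (W : Reach S u v) → x ∈ vertices W → WalkIn G (_∈ vertices W) u x
  vertices-walk (here p) (here refl) = stop (here refl)
  vertices-walk (step uw W) (here refl) = stop (here refl)
  vertices-walk (step uw W) (there x∈) = move (here refl) (E-adj S uw) (walk-map there (vertices-walk W x∈))

-- Membership in a subgraph is not decidable, so each subgraph is replaced by
-- the finitely many vertices on walks to the common vertices supplied by pp;
-- c ranges over the codes of p-tuples.
module Trimming {n m d : ℕ} {G : Graph n} (p : ℕ) (H : Fin m → Subgraph G)
  (components : ∀ k → AtMostComponents d (H k)) (pp : PPProperty p H) where

  tuple : Fin (m ^ p) → Fin p → Fin m
  tuple = finToFun

  source : Fin m → Fin d → Fin n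
  source k = proj₁ (components k)

  reach : ∀ c i → ∃ λ j → Reach (H (tuple c i)) (source (tuple c i) j) (proj₁ (pp (tuple c)))
  reach c i = proj₂ (components (tuple c i)) _ (proj₂ (pp (tuple c)) i)

  path : Fin (m ^ p) → Fin p → List (Fin n)
  path c i = vertices (proj₂ (reach c i))

  Trimmed : Fin m → Fin n → Set
  Trimmed k v = ∃ λ c → ∃ λ i → tuple c i ≡ k × v ∈ path c i

  trimmed? : ∀ k → Decidable (Trimmed k)
  trimmed? k v = any? λ c → any? λ i → (tuple c i ≟ k) ×-dec (_∈?_ _≟_ v (path c i))

  trimmed-V : ∀ {k v} → Trimmed k v → V (H k) v
  trimmed-V (c , i , refl , v∈) = vertices-V (proj₂ (reach c i)) v∈

  trimmed-connected : ∀ k v → Trimmed k v → ∃ λ j → WalkIn G (Trimmed k) (source k j) v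
  trimmed-connected k v (c , i , refl , v∈) =
    proj₁ (reach c i) , walk-map (λ x∈ → c , i , refl , x∈) (vertices-walk (proj₂ (reach c i)) v∈)

  trimmed-common : ∀ (f : Fin p → Fin m) → ∃ λ v → ∀ i → Trimmed (f i) v
  -- `pp` is applied to the decoded tuple, from which `path` is built; it agrees with `f` pointwise.
  -- The common vertex ends each of these paths, so trimming keeps it.
  trimmed-common f = proj₁ (pp (tuple (funToFin f))) , λ i →
    funToFin f , i , finToFun-funToFin f i , end∈vertices (proj₂ (reach (funToFin f) i))

transversal-exists : ∀ {n m} {G : Graph n} → IsTree G → ∀ e d₁ (H : Fin m → Subgraph G) →
  (∀ k → AtMostComponents (suc d₁) (H k)) → PPProperty (suc (suc e)) H → Fin n →
  ∃ λ T → Transversal H T × (length T ∸ suc d₁) ^ suc e < suc (suc e) * suc d₁ ^ suc (suc e)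
transversal-exists tree e d₁ H components pp v₀ =
  let T , hits , small = transversal-bound (tree-rooting tree v₀) trimmed? source trimmed-connected e trimmed-common v₀
  in T , (λ k → let v , v∈T , v∈ = hits k in v , v∈T , trimmed-V v∈) , small
  where open Trimming (suc (suc e)) H components pp

theorem1p3 : (n : ℕ) (G : Graph n) → IsTree G →
    (p : ℕ) → 2 ≤ p → (d : ℕ) → 1 ≤ d →
    (m : ℕ) (H : Fin m → Subgraph G) → (∀ k → AtMostComponents d (H k)) →
    PPProperty p H →
    Σ (List (Fin n)) λ T → Unique T × Transversal H T ×
    ((length T ∸ d) ^ (p ∸ 1) < p * d ^ p)
theorem1p3 n G tree (suc (suc e)) (s≤s (s≤s z≤n)) (suc d₁) (s≤s z≤n) zero H components pp =
  -- An empty collection supplies no vertex to root at; the empty transversal has excess 0.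
  [] , [] , (λ ()) , positive-bound (suc e) d₁
theorem1p3 n G tree (suc (suc e)) (s≤s (s≤s z≤n)) (suc d₁) (s≤s z≤n) (suc m) H components pp =
  -- The root is the common vertex of a constant tuple. Removing duplicates from `T` can only
  -- shorten it.
  let T , transversal , small = transversal-exists tree e d₁ H components pp (proj₁ (pp (λ _ → zero)))
  in deduplicate _≟_ T , deduplicate-! _≟_ T ,
     (λ k → let v , v∈T , v∈ = transversal k in v , ∈-deduplicate⁺ _≟_ v∈T , v∈) ,
     ≤-<-trans (^-monoˡ-≤ (suc e) (∸-monoˡ-≤ (suc d₁) (length-deduplicate _≟_ T))) small
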